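{- Let $\phi(x) = x^d + c$, where $c,d \in \mathbb{Z}$ and $d \geq 2$. Let $G$ be the index divisibility graph corresponding to $\phi$, and let $G_V$ be the vertex set of $G$. Then $G_V = D_{d,c}$, where $D_{d,c} = \{n \in \mathbb{Z} : n \ge 1,\ n \mid \phi^n(0)\}$.
   Context: Here $\phi^n$ denotes the $n$-th iterate of $\phi$. Define $D_{d,c} = \{n \in \mathbb{Z} : n \geq 1,\ n \mid \phi^n(0)\}$ and $P_{d,c} = \{p \in D_{d,c} : p \text{ is prime}\}$. Let $v_p$ denote the $p$-adic valuation on integers, with the convention $v_p(0) = \infty$. The index divisibility graph $G$ of $\phi$ is the directed graph constructed iteratively as follows. Initially $1$ is in the vertex set $G_V$. For each $n \in G_V$, adjoin the vertex $np$ and the directed edge $(n, np)$ if at least one of the following holds: (type 1) $p$ is a prime satisfying $v_p(\phi^n(0)) > v_p(n)$; (type 2) $p \in P_{d,c}$ and $v_p(n) = 0$. Thus $G_V$ is the smallest set of positive integers containing $1$ and closed under these rules. -}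

module Defs where

open import Data.Integer.Base as ℤ using (ℤ; +_; 0ℤ; ∣_∣)
open import Data.Integer.Divisibility.Signed using (_∣_)
open import Data.Nat.Base as ℕ using (ℕ; zero; suc; _≤_)
import Data.Nat.Divisibility as ℕ
open import Data.Nat.GeneralisedArithmetic using (iterate)
open import Data.Nat.Primality using (Prime)
open import Data.Product.Base using (_×_)
open import Level using (0ℓ)
open import Relation.Binary.Core using (Rel)
open import Relation.Binary.Construct.Add.Supremum.Strict ℕ._<_ using (_<⁺_)
open import Relation.Binary.PropositionalEquality.Core using (_≡_)
open import Relation.Nullary.Construct.Add.Supremum using (_⁺; [_]; ⊤⁺)
open import Relation.Nullary.Decidable.Core using (yes; no)
open import Relation.Unary using (Pred)

φ : ℕ → ℤ → ℤ → ℤ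
φ d c x = x ℤ.^ d ℤ.+ c

φ^[_]0 : ℕ → ℕ → ℤ → ℤ
φ^[ n ]0 d c = iterate (φ d c) 0ℤ n

D : ℕ → ℤ → Pred ℕ 0ℓ
D d c n = 1 ≤ n × (+ n) ∣ φ^[ n ]0 d c

P : ℕ → ℤ → Pred ℕ 0ℓ
P d c p = Prime p × D d c p

-- The largest k ≤ b with p ^ k ∣ m.
largestPower : (p m b : ℕ) → ℕ
largestPower p m zero = 0
largestPower p m (suc b) with (p ℕ.^ suc b) ℕ.∣? m
... | yes _ = suc b
... | no  _ = largestPower p m b

-- The p-adic valuation, with ⊤⁺ playing the role of ∞; meaningful for p ≥ 2.
-- With m = ∣ z ∣ ≠ 0, if p ^ k ∣ m then k < p ^ k ≤ m, so the search bound m loses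
-- nothing.
v : ℕ → ℤ → ℕ ⁺
v p z with ∣ z ∣
... | zero        = ⊤⁺
... | m@(suc _) = [ largestPower p m m ]

-- Step d c n p: from the vertex n one adjoins the vertex n * p.
data Step (d : ℕ) (c : ℤ) (n p : ℕ) : Set where
  type₁ : Prime p → v p (+ n) <⁺ v p (φ^[ n ]0 d c) → Step d c n p
  type₂ : P d c p → v p (+ n) ≡ [ 0 ] → Step d c n p

data Vertex (d : ℕ) (c : ℤ) : Pred ℕ 0ℓ where
  one    : Vertex d c 1
  adjoin : ∀ {n p} → Vertex d c n → Step d c n p → Vertex d c (n ℕ.* p)

data Edge (d : ℕ) (c : ℤ) : Rel ℕ 0ℓ where
  edge : ∀ {n p} → Vertex d c n → Step d c n p → Edge d c n (n ℕ.* p)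

record Digraph : Set₁ where
  field
    vertices : Pred ℕ 0ℓ
    edges    : Rel ℕ 0ℓ

G : ℕ → ℤ → Digraph
G d c = record { vertices = Vertex d c ; edges = Edge d c }

{-# OPTIONS --safe #-}
-- Write aₙ = φⁿ(0).  If z ∣ aₘ then iterating from aₘ or from 0 is the same modulo z, so
-- { n ∣ z ∣ aₙ } is closed under gcds and multiples; since φ(x) − φ(0) = x ^ d with
-- d ≥ 2, moreover aₘ² ∣ aₖₘ − aₘ, so aₖₘ = u aₘ with u prime to aₘ.  By pigeonhole a prime
-- q ∣ aₙ also divides some a_g with g ∣ n and g ≤ q.
-- For D ⊆ G_V remove from n = m p the greatest prime p.  For a prime q ∣ m, the above g
-- satisfies g ≤ q ≤ p, so g ∣ m or g = p = q; both give q ∣ aₘ, hence m ∣ aₘ by the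
-- coprimality of u and m.  If p ∣ aₘ, the same argument gives m p ∣ aₘ, a step of type 1.
-- Otherwise p ∤ m and the g of q = p does not divide m, so g = p: a step of type 2.
module Submission where

open import Defs
open import Data.Fin.Base using (toℕ; fromℕ<)
open import Data.Fin.Properties using (pigeonhole; fromℕ<-injective; toℕ<n)
open import Data.Integer.Base as ℤ using (ℤ; +_; +[1+_]; -[1+_]; 0ℤ; 1ℤ; ∣_∣)
import Data.Integer.Coprimality as ℤ
import Data.Integer.DivMod as ℤ
open import Data.Integer.Divisibility.Signed as ℤ using (∣ᵤ⇒∣; ∣⇒∣ᵤ)
import Data.Integer.Properties as ℤ
open import Data.Integer.Tactic.RingSolver using (solve-∀)
open import Data.List.Base using ([]; _∷_)
open import Data.List.Extrema.Nat using (max; xs≤max; ⊥≤max; argmax-sel)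
open import Data.List.Membership.Propositional using (_∈_)
open import Data.List.Relation.Unary.All as All using (_∷_)
open import Data.List.Relation.Unary.Any using (here; there)
open import Data.Nat.Base
open import Data.Nat.Coprimality as Coprimality using (Coprime; coprime-divisor)
open import Data.Nat.Divisibility
open import Data.Nat.GCD using (gcd; gcd-GCD; gcd[m,n]∣m; gcd[m,n]≤n; module Bézout)
open import Data.Nat.GeneralisedArithmetic using (iterate)
open import Data.Nat.Induction using (<-rec)
open import Data.Nat.ListAction.Properties using (∈⇒∣product)
open import Data.Nat.Primality
open import Data.Nat.Primality.Factorisation
open import Data.Nat.Properties
open import Data.Product.Base using (∃-syntax; _×_; _,_)
open import Data.Sum.Base using (_⊎_; inj₁; inj₂)
open import Function.Base using (_∘_; id)
open import Relation.Binary.Construct.Add.Supremum.Strict _<_ using (_<⁺_; [_]; [_]<⊤⁺)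
open import Relation.Binary.PropositionalEquality
open import Relation.Nullary.Construct.Add.Supremum using ([_])
open import Relation.Nullary.Decidable.Core using (yes; no)
open import Relation.Nullary.Negation.Core using (¬_; contradiction)
open import Relation.Unary using (_≐_)

-- Primes

prime∣prime⇒≡ : ∀ {p q} → Prime p → Prime q → q ∣ p → q ≡ p
prime∣prime⇒≡ p-prime q-prime q∣p with prime⇒irreducible p-prime q∣p
... | inj₁ refl = contradiction q-prime ¬prime[1]
... | inj₂ q≡p  = q≡p

prime∣^⇒∣ : ∀ {q} m n → Prime q → q ∣ m ^ n → q ∣ m
prime∣^⇒∣ m zero    q-prime q∣1 with refl ← ∣1⇒≡1 q∣1 = contradiction q-prime ¬prime[1]
prime∣^⇒∣ m (suc n) q-prime q∣m^1+n with euclidsLemma m (m ^ n) q-prime q∣m^1+n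
... | inj₁ q∣m   = q∣m
... | inj₂ q∣m^n = prime∣^⇒∣ m n q-prime q∣m^n

greatestPrimeDivisor : ∀ n → .{{NonTrivial n}} →
  ∃[ p ] Prime p × p ∣ n × (∀ {q} → Prime q → q ∣ n → q ≤ p)
greatestPrimeDivisor n@(2+ _) with factorise n
... | record { factors = [] ; isFactorisation = () }
... | record { factors = x ∷ xs ; isFactorisation = n≡Π ; factorsPrime = primes } =
  p , All.lookup primes p∈ , subst (p ∣_) (sym n≡Π) (∈⇒∣product p∈) , greatest
  where
  -- The head `x` serves as the base value of `max`, so the maximum is itself one of the prime
  -- factors.
  p = max x xs

  p∈ : p ∈ x ∷ xs
  p∈ with argmax-sel id x xs
  ... | inj₁ p≡x  = here p≡x
  ... | inj₂ p∈xs = there p∈xs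

  greatest : ∀ {q} → Prime q → q ∣ n → q ≤ p
  greatest {q} q-prime q∣n = All.lookup (⊥≤max x xs ∷ xs≤max x xs)
    (factorisationHasAllPrimeFactors q-prime (subst (q ∣_) n≡Π q∣n) primes)

-- A common divisor of at least 2 would have a prime factor shared by `m` and `n`; the common
-- divisor 0 is ruled out by `m` being nonzero.
noCommonPrime⇒coprime : ∀ {m n} → .{{NonZero m}} →
  (∀ {q} → Prime q → q ∣ m → ¬ q ∣ n) → Coprime m n
noCommonPrime⇒coprime {m} _  {zero} (0∣m , _) = contradiction (0∣⇒≡0 0∣m) (≢-nonZero⁻¹ m)
noCommonPrime⇒coprime     _  {1}    _         = refl
noCommonPrime⇒coprime     no-common {2+ d} (d∣m , d∣n)
  with q , q-prime , q∣d , _ ← greatestPrimeDivisor (2+ d) =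
  contradiction (∣-trans q∣d d∣n) (no-common q-prime (∣-trans q∣d d∣m))

prime∤⇒coprime : ∀ {p n} → Prime p → ¬ p ∣ n → Coprime p n
prime∤⇒coprime {p} {n} p-prime p∤n = noCommonPrime⇒coprime λ q-prime q∣p q∣n →
  p∤n (subst (_∣ n) (prime∣prime⇒≡ p-prime q-prime q∣p) q∣n)
  where instance _ = prime⇒nonZero p-prime

coprime-*-∣ : ∀ {m n o} → Coprime m n → m ∣ o → n ∣ o → m * n ∣ o
coprime-*-∣ {m} {n} m⊥n (divides-refl t) n∣tm = subst (m * n ∣_) (*-comm m t)
  (*-monoʳ-∣ m (coprime-divisor (Coprimality.sym m⊥n) (subst (n ∣_) (*-comm t m) n∣tm)))

-- Valuations

largestPower-∣ : ∀ p m b → p ^ largestPower p m b ∣ m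
largestPower-∣ p m zero = 1∣ m
largestPower-∣ p m (suc b) with p ^ suc b ∣? m
... | yes p^1+b∣m = p^1+b∣m
... | no  _       = largestPower-∣ p m b

≤-largestPower : ∀ {p m k} b → k ≤ b → p ^ k ∣ m → k ≤ largestPower p m b
≤-largestPower zero k≤0 _ = k≤0
≤-largestPower {p} {m} (suc b) k≤1+b p^k∣m with p ^ suc b ∣? m
... | yes _       = k≤1+b
... | no  p^1+b∤m with m≤n⇒m<n∨m≡n k≤1+b
...   | inj₁ (s≤s k≤b) = ≤-largestPower b k≤b p^k∣m
...   | inj₂ refl      = contradiction p^k∣m p^1+b∤m

n<m^n : ∀ m n → .{{NonTrivial m}} → n < m ^ n
n<m^n m@(2+ _) zero    = z<s
n<m^n m@(2+ _) (suc n) = ≤-<-trans (n<m^n m n) (^-monoʳ-< m (s<s z<s) (n<1+n n))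

-- The chain `k < p ^ k ≤ m` keeps `k` within the search bound.
^∣⇒≤largestPower : ∀ {p m k} → .{{NonTrivial p}} → .{{NonZero m}} →
  p ^ k ∣ m → k ≤ largestPower p m m
^∣⇒≤largestPower {p} {m} {k} p^k∣m =
  ≤-largestPower m (≤-trans (<⇒≤ (n<m^n p k)) (∣⇒≤ p^k∣m)) p^k∣m

-- Write `n` as `t * p ^ k` with `k` maximal, so that `p` does not divide `t`. Then `n * p` is
-- `t * p ^ suc k`, a product of coprime divisors of `m`.
largestPower-<⇒*∣ : ∀ {p n m} → Prime p → .{{NonZero n}} →
  largestPower p n n < largestPower p m m → n ∣ m → n * p ∣ m
largestPower-<⇒*∣ {p} {n} {m} p-prime k<l n∣m with largestPower-∣ p n n
... | divides t n≡tp^k = subst (_∣ m) (sym np≡tp^1+k)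
  (coprime-*-∣ t⊥p^1+k
    (∣-trans (divides (p ^ k) (trans n≡tp^k (*-comm t (p ^ k)))) n∣m)
    (∣-trans p^1+k∣p^l (largestPower-∣ p m m)))
  where
  k = largestPower p n n
  instance
    _ = prime⇒nonTrivial p-prime

  np≡tp^1+k : n * p ≡ t * p ^ suc k
  np≡tp^1+k = begin
    n * p           ≡⟨ cong (_* p) n≡tp^k ⟩
    t * p ^ k * p   ≡⟨ *-assoc t (p ^ k) p ⟩
    t * (p ^ k * p) ≡⟨ cong (t *_) (*-comm (p ^ k) p) ⟩
    t * p ^ suc k   ∎
    where open ≡-Reasoning

  p∤t : ¬ p ∣ t
  p∤t p∣t = <-irrefl refl (^∣⇒≤largestPower
    (subst (p ^ suc k ∣_) (sym n≡tp^k) (*-monoˡ-∣ (p ^ k) p∣t)))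

  t⊥p^1+k : Coprime t (p ^ suc k)
  t⊥p^1+k = Coprimality.sym (noCommonPrime⇒coprime λ q-prime q∣p^1+k q∣t →
    p∤t (subst (_∣ t)
      (prime∣prime⇒≡ p-prime q-prime (prime∣^⇒∣ p (suc k) q-prime q∣p^1+k)) q∣t))
    where instance _ = m^n≢0 p (suc k) {{nonTrivial⇒nonZero p}}

  p^1+k∣p^l : p ^ suc k ∣ p ^ largestPower p m m
  p^1+k∣p^l = m≤n⇒m^o∣m^n k<l
    where
    m≤n⇒m^o∣m^n : ∀ {i j} → i ≤ j → p ^ i ∣ p ^ j
    m≤n⇒m^o∣m^n {j = j} z≤n = 1∣ (p ^ j)
    m≤n⇒m^o∣m^n (s≤s i≤j)   = *-monoʳ-∣ p (m≤n⇒m^o∣m^n i≤j)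

*∣⇒largestPower-< : ∀ {p n m} → .{{NonTrivial p}} → .{{NonZero m}} →
  n * p ∣ m → largestPower p n n < largestPower p m m
*∣⇒largestPower-< {p} {n} {m} np∣m = ^∣⇒≤largestPower (∣-trans
  (subst (_∣ n * p) (*-comm (p ^ k) p) (*-monoˡ-∣ p (largestPower-∣ p n n))) np∣m)
  where k = largestPower p n n

-- With `*∣⇒v-<`, this trades the valuation condition of a type 1 step for a divisibility. For `z`
-- zero the valuation is `⊤⁺` and every number divides `z`.
v-<⇒*∣ : ∀ {p n z} → Prime p → .{{NonZero n}} →
  v p (+ n) <⁺ v p z → + n ℤ.∣ z → + (n * p) ℤ.∣ z
v-<⇒*∣ {n = suc _} {+ zero}   _       _     _   = ∣ᵤ⇒∣ (_ ∣0)
v-<⇒*∣ {n = suc _} {+[1+ _ ]} p-prime [ l ] n∣z = ∣ᵤ⇒∣ (largestPower-<⇒*∣ p-prime l (∣⇒∣ᵤ n∣z))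
v-<⇒*∣ {n = suc _} { -[1+ _ ]} p-prime [ l ] n∣z = ∣ᵤ⇒∣ (largestPower-<⇒*∣ p-prime l (∣⇒∣ᵤ n∣z))

*∣⇒v-< : ∀ {p n z} → Prime p → .{{NonZero n}} →
  + (n * p) ℤ.∣ z → v p (+ n) <⁺ v p z
*∣⇒v-< {n = suc _} {+ zero}   _       _    = [ _ ]<⊤⁺
*∣⇒v-< {n = suc _} {+[1+ _ ]} p-prime np∣z = [ *∣⇒largestPower-< (∣⇒∣ᵤ np∣z) ]
  where instance _ = prime⇒nonTrivial p-prime
*∣⇒v-< {n = suc _} { -[1+ _ ]} p-prime np∣z = [ *∣⇒largestPower-< (∣⇒∣ᵤ np∣z) ]
  where instance _ = prime⇒nonTrivial p-prime

v≡0⇒∤ : ∀ {p n} → Prime p → .{{NonZero n}} → v p (+ n) ≡ [ 0 ] → ¬ p ∣ n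
v≡0⇒∤ {p} {n@(suc _)} p-prime v≡0 p∣n with largestPower p n n in eq
v≡0⇒∤ {p} {n@(suc _)} p-prime refl p∣n | 0 =
  contradiction (subst (1 ≤_) eq (^∣⇒≤largestPower (subst (_∣ n) (sym (^-identityʳ p)) p∣n))) λ ()
  where instance _ = prime⇒nonTrivial p-prime

∤⇒v≡0 : ∀ {p n} → .{{NonZero n}} → ¬ p ∣ n → v p (+ n) ≡ [ 0 ]
∤⇒v≡0 {p} {n@(suc _)} p∤n with largestPower p n n | largestPower-∣ p n n
... | zero  | _       = refl
... | suc k | p^1+k∣n = contradiction (∣-trans (m∣m*n (p ^ k)) p^1+k∣n) p∤n

-- Integer congruences

∣-∣ʳ⇒∣ˡ : ∀ {z x y} → z ℤ.∣ x ℤ.- y → z ℤ.∣ y → z ℤ.∣ x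
∣-∣ʳ⇒∣ˡ {x = x} z∣x-y z∣y = ℤ.∣m+n∣n⇒∣m {m = x} z∣x-y (ℤ.∣m⇒∣-m z∣y)

∣-∣ˡ⇒∣ʳ : ∀ {z x y} → z ℤ.∣ x ℤ.- y → z ℤ.∣ x → z ℤ.∣ y
∣-∣ˡ⇒∣ʳ {z} {x} {y} z∣x-y z∣x = subst (z ℤ.∣_) (ℤ.neg-involutive y)
  (ℤ.∣m⇒∣-m (ℤ.∣m+n∣m⇒∣n {m = x} z∣x-y z∣x))

%ℕ-≡⇒∣- : ∀ q {x y} → .{{_ : NonZero q}} → x ℤ.%ℕ q ≡ y ℤ.%ℕ q → + q ℤ.∣ x ℤ.- y
%ℕ-≡⇒∣- q {x} {y} eq = ℤ.divides (x ℤ./ℕ q ℤ.- y ℤ./ℕ q) (begin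
  x ℤ.- y
    ≡⟨ cong₂ ℤ._-_ (ℤ.a≡a%ℕn+[a/ℕn]*n x q) (ℤ.a≡a%ℕn+[a/ℕn]*n y q) ⟩
  (+ (x ℤ.%ℕ q) ℤ.+ (x ℤ./ℕ q) ℤ.* + q) ℤ.- (+ (y ℤ.%ℕ q) ℤ.+ (y ℤ./ℕ q) ℤ.* + q)
    ≡⟨ cong (λ r → (+ r ℤ.+ (x ℤ./ℕ q) ℤ.* + q) ℤ.- (+ (y ℤ.%ℕ q) ℤ.+ (y ℤ./ℕ q) ℤ.* + q)) eq ⟩
  (+ (y ℤ.%ℕ q) ℤ.+ (x ℤ./ℕ q) ℤ.* + q) ℤ.- (+ (y ℤ.%ℕ q) ℤ.+ (y ℤ./ℕ q) ℤ.* + q)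
    ≡⟨ identity (+ (y ℤ.%ℕ q)) (x ℤ./ℕ q) (y ℤ./ℕ q) (+ q) ⟩
  (x ℤ./ℕ q ℤ.- y ℤ./ℕ q) ℤ.* + q ∎)
  where
  open ≡-Reasoning

  identity : ∀ r s t q → (r ℤ.+ s ℤ.* q) ℤ.- (r ℤ.+ t ℤ.* q) ≡ (s ℤ.- t) ℤ.* q
  identity = solve-∀

^-cong-∣ : ∀ x y n → (x ℤ.- y) ℤ.∣ (x ℤ.^ n ℤ.- y ℤ.^ n)
^-cong-∣ x y zero    = ∣ᵤ⇒∣ (_ ∣0)
^-cong-∣ x y (suc n) = subst (x ℤ.- y ℤ.∣_) (identity x y (x ℤ.^ n) (y ℤ.^ n))
  (ℤ.∣m∣n⇒∣m+n (ℤ.∣n⇒∣m*n x (^-cong-∣ x y n)) (ℤ.∣m⇒∣m*n (y ℤ.^ n) ℤ.∣-refl))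
  where
  identity : ∀ x y s t → x ℤ.* (s ℤ.- t) ℤ.+ (x ℤ.- y) ℤ.* t ≡ x ℤ.* s ℤ.- y ℤ.* t
  identity = solve-∀

+-cancelʳ-- : ∀ x y c → (x ℤ.+ c) ℤ.- (y ℤ.+ c) ≡ x ℤ.- y
+-cancelʳ-- = solve-∀

iterate-+ : ∀ {A : Set} (f : A → A) x m n → iterate f x (m + n) ≡ iterate f (iterate f x m) n
iterate-+ f x zero    n = refl
iterate-+ f x (suc m) n = iterate-+ f (f x) m n

-- The orbit of 0

module _ (d : ℕ) (c : ℤ) where

  private
    a : ℕ → ℤ
    a n = φ^[ n ]0 d c

  φ-cong-∣ : ∀ x y → (x ℤ.- y) ℤ.∣ (φ d c x ℤ.- φ d c y)
  φ-cong-∣ x y = subst (x ℤ.- y ℤ.∣_) (sym (+-cancelʳ-- (x ℤ.^ d) (y ℤ.^ d) c)) (^-cong-∣ x y d)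

  iterate-cong-∣ : ∀ x y n → (x ℤ.- y) ℤ.∣ (iterate (φ d c) x n ℤ.- iterate (φ d c) y n)
  iterate-cong-∣ x y zero    = ℤ.∣-refl
  iterate-cong-∣ x y (suc n) =
    ℤ.∣-trans (φ-cong-∣ x y) (iterate-cong-∣ (φ d c x) (φ d c y) n)

  orbit-shift : ∀ i j n → (a i ℤ.- a j) ℤ.∣ (a (i + n) ℤ.- a (j + n))
  orbit-shift i j n = subst₂ (λ x y → (a i ℤ.- a j) ℤ.∣ (x ℤ.- y))
    (sym (iterate-+ (φ d c) 0ℤ i n)) (sym (iterate-+ (φ d c) 0ℤ j n))
    (iterate-cong-∣ (a i) (a j) n)

  -- Since `a 0` is 0, the case `j = 0` of `orbit-shift` says that the orbit has period `m` modulo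
  -- `a m`.
  orbit-periodic : ∀ m n → a m ℤ.∣ (a (m + n) ℤ.- a n)
  orbit-periodic m n = subst (ℤ._∣ (a (m + n) ℤ.- a n)) (ℤ.+-identityʳ (a m)) (orbit-shift m 0 n)

  ∣-orbit-+ : ∀ {z} m n → z ℤ.∣ a m → z ℤ.∣ a n → z ℤ.∣ a (m + n)
  ∣-orbit-+ m n z∣aₘ z∣aₙ =
    ∣-∣ʳ⇒∣ˡ {x = a (m + n)} (ℤ.∣-trans z∣aₘ (orbit-periodic m n)) z∣aₙ

  ∣-orbit-+⁻ : ∀ {z} m n → z ℤ.∣ a m → z ℤ.∣ a (m + n) → z ℤ.∣ a n
  ∣-orbit-+⁻ m n z∣aₘ z∣aₘ₊ₙ =
    ∣-∣ˡ⇒∣ʳ {x = a (m + n)} (ℤ.∣-trans z∣aₘ (orbit-periodic m n)) z∣aₘ₊ₙ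

  ∣-orbit-* : ∀ {z} k m → z ℤ.∣ a m → z ℤ.∣ a (k * m)
  ∣-orbit-* zero    m z∣aₘ = ∣ᵤ⇒∣ (_ ∣0)
  ∣-orbit-* (suc k) m z∣aₘ = ∣-orbit-+ m (k * m) z∣aₘ (∣-orbit-* k m z∣aₘ)

  ∣-orbit-∣ : ∀ {z m n} → m ∣ n → z ℤ.∣ a m → z ℤ.∣ a n
  ∣-orbit-∣ {m = m} (divides-refl k) = ∣-orbit-* k m

  -- Bézout over the naturals writes a multiple of one index as `gcd m n` plus a multiple of the
  -- other, and `∣-orbit-+⁻` cancels the latter. The two cases record which multiple is larger.
  ∣-orbit-gcd : ∀ {z} m n → z ℤ.∣ a m → z ℤ.∣ a n → z ℤ.∣ a (gcd m n)
  ∣-orbit-gcd {z} m n z∣aₘ z∣aₙ with Bézout.identity (gcd-GCD m n)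
  ... | Bézout.+- x y eq = ∣-orbit-+⁻ (y * n) (gcd m n) (∣-orbit-* y n z∣aₙ)
    (subst (λ k → z ℤ.∣ a k) (trans (sym eq) (+-comm (gcd m n) (y * n))) (∣-orbit-* x m z∣aₘ))
  ... | Bézout.-+ x y eq = ∣-orbit-+⁻ (x * m) (gcd m n) (∣-orbit-* x m z∣aₘ)
    (subst (λ k → z ℤ.∣ a k) (trans (sym eq) (+-comm (gcd m n) (x * m))) (∣-orbit-* y n z∣aₙ))

  -- Among `a 0`, ..., `a q` two values agree modulo `q`, at indices `i < j`. Shifting both so that
  -- `i` lands on a multiple of `n` gives `q ∣ a b` for the gap `b ≤ q`; the witness `g` is the gcd
  -- of `n` and `b`.
  ∣-orbit⇒∣-orbit-≤ : ∀ q n → .{{NonZero q}} → .{{NonZero n}} → + q ℤ.∣ a n →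
    ∃[ g ] g ∣ n × g ≤ q × + q ℤ.∣ a g
  ∣-orbit⇒∣-orbit-≤ q n@(suc n′) q∣aₙ
    with i , j , i<j , eq ← pigeonhole (n<1+n q) (λ i → fromℕ< (ℤ.n%ℕd<d (a (toℕ i)) q)) =
    gcd n b , gcd[m,n]∣m n b ,
    ≤-trans (gcd[m,n]≤n n b) (≤-trans (m∸n≤m (toℕ j) (toℕ i)) (s≤s⁻¹ (toℕ<n j))) ,
    ∣-orbit-gcd n b q∣aₙ (∣-orbit-+⁻ (toℕ i * n) b q∣aᵢₙ q∣aᵢₙ₊b)
    where
    b = toℕ j ∸ toℕ i
    -- Chosen so that `i + t` is `i * n`, where `q` divides the orbit; `j + t` is then `i * n + b`.
    t = toℕ i * n′
    instance _ = >-nonZero (m<n⇒0<n∸m i<j)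

    q∣aⱼ-aᵢ : + q ℤ.∣ (a (toℕ j) ℤ.- a (toℕ i))
    q∣aⱼ-aᵢ = %ℕ-≡⇒∣- q {a (toℕ j)} {a (toℕ i)} (sym (fromℕ<-injective _ _
      (ℤ.n%ℕd<d (a (toℕ i)) q) (ℤ.n%ℕd<d (a (toℕ j)) q) eq))

    q∣aᵢₙ : + q ℤ.∣ a (toℕ i * n)
    q∣aᵢₙ = ∣-orbit-* (toℕ i) n q∣aₙ

    i+t≡in : toℕ i + t ≡ toℕ i * n
    i+t≡in = sym (*-suc (toℕ i) n′)

    j+t≡in+b : toℕ j + t ≡ toℕ i * n + b
    j+t≡in+b = begin
      toℕ j + t           ≡⟨ cong (_+ t) (m∸n+n≡m (<⇒≤ i<j)) ⟨
      b + toℕ i + t       ≡⟨ +-assoc b (toℕ i) t ⟩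
      b + (toℕ i + t)     ≡⟨ cong (λ k → b + k) i+t≡in ⟩
      b + toℕ i * n       ≡⟨ +-comm b (toℕ i * n) ⟩
      toℕ i * n + b       ∎
      where open ≡-Reasoning

    q∣aᵢₙ₊b : + q ℤ.∣ a (toℕ i * n + b)
    q∣aᵢₙ₊b = subst (λ k → + q ℤ.∣ a k) j+t≡in+b
      (∣-∣ʳ⇒∣ˡ {x = a (toℕ j + t)} (ℤ.∣-trans q∣aⱼ-aᵢ (orbit-shift (toℕ j) (toℕ i) t))
        (subst (λ k → + q ℤ.∣ a k) (sym i+t≡in) q∣aᵢₙ))

  vertex⇒nonZero : ∀ {n} → Vertex d c n → NonZero n
  vertex⇒nonZero one = _
  vertex⇒nonZero (adjoin {n} {p} n∈G s) = m*n≢0 n p {{vertex⇒nonZero n∈G}} {{p≢0 s}}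
    where
    p≢0 : Step d c n p → NonZero p
    p≢0 (type₁ p-prime _)       = prime⇒nonZero p-prime
    p≢0 (type₂ (p-prime , _) _) = prime⇒nonZero p-prime

  -- Type 1 gives `n * p ∣ a n`, which passes to the multiple `n * p` of the index. In type 2, `n`
  -- and `p` are coprime and both divide `a (n * p)`.
  vertex⇒∣-orbit : ∀ {n} → Vertex d c n → + n ℤ.∣ a n
  vertex⇒∣-orbit one = ∣ᵤ⇒∣ (1∣ _)
  vertex⇒∣-orbit (adjoin {n} {p} n∈G (type₁ p-prime v<v)) =
    ∣-orbit-∣ {m = n} (m∣m*n p) (v-<⇒*∣ p-prime v<v (vertex⇒∣-orbit n∈G))
    where instance _ = vertex⇒nonZero n∈G
  vertex⇒∣-orbit (adjoin {n} {p} n∈G (type₂ (p-prime , _ , p∣aₚ) v≡0)) = ∣ᵤ⇒∣ (coprime-*-∣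
    (Coprimality.sym (prime∤⇒coprime p-prime (v≡0⇒∤ p-prime v≡0)))
    (∣⇒∣ᵤ (∣-orbit-∣ {m = n} (m∣m*n p) (vertex⇒∣-orbit n∈G)))
    (∣⇒∣ᵤ (∣-orbit-∣ {m = p} (n∣m*n n) p∣aₚ)))
    where instance _ = vertex⇒nonZero n∈G

-- Rigidity

-- Here `2 ≤ d` enters: it lets `x * x` split off from `x ^ d`.
φ-square : ∀ {d} c x → 2 ≤ d → (x ℤ.* x) ℤ.∣ (φ d c x ℤ.- φ d c 0ℤ)
φ-square {1}    c x (s≤s ())
φ-square {2+ d} c x _ =
  subst (x ℤ.* x ℤ.∣_) (sym (φx-φ0 x (x ℤ.^ d) c)) (ℤ.∣m⇒∣m*n (x ℤ.^ d) ℤ.∣-refl)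
  where
  φx-φ0 : ∀ x y c → (x ℤ.* (x ℤ.* y) ℤ.+ c) ℤ.- (0ℤ ℤ.+ c) ≡ x ℤ.* x ℤ.* y
  φx-φ0 = solve-∀

module _ (d : ℕ) (c : ℤ) (2≤d : 2 ≤ d) where

  private
    a : ℕ → ℤ
    a n = φ^[ n ]0 d c

  -- The first application of `φ` gains the square; the other `n` preserve the congruence.
  iterate-square : ∀ x n → (x ℤ.* x) ℤ.∣ (iterate (φ d c) x (suc n) ℤ.- a (suc n))
  iterate-square x n =
    ℤ.∣-trans (φ-square c x 2≤d) (iterate-cong-∣ d c (φ d c x) (φ d c 0ℤ) n)

  -- As `a m` divides `a (k * m)`, its square divides the square of `a (k * m)`, modulo which `m`
  -- iterations from `a (k * m)` and from 0 agree.
  orbit-rigid : ∀ k m → (a m ℤ.* a m) ℤ.∣ (a (suc k * m) ℤ.- a m)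
  -- `iterate-square` needs at least one iteration; for `m = 0` the divisor and the difference are
  -- both 0.
  orbit-rigid k zero rewrite *-zeroʳ k = ℤ.∣-refl
  orbit-rigid k m@(suc m′) = ℤ.∣-trans
    (ℤ.∣-trans (ℤ.*-monoʳ-∣ (a m) aₘ∣aₖₘ) (ℤ.*-monoˡ-∣ (a (k * m)) aₘ∣aₖₘ))
    (subst (λ x → (a (k * m) ℤ.* a (k * m)) ℤ.∣ (x ℤ.- a m)) iterate≡ (iterate-square (a (k * m)) m′))
    where
    aₘ∣aₖₘ : a m ℤ.∣ a (k * m)
    aₘ∣aₖₘ = ∣-orbit-* d c k m ℤ.∣-refl

    iterate≡ : iterate (φ d c) (a (k * m)) m ≡ a (suc k * m)
    iterate≡ = trans (sym (iterate-+ (φ d c) 0ℤ (k * m) m)) (cong a (+-comm (k * m) m))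

  -- By rigidity `a (k * m)` is `u * a m` with `u` congruent to 1 modulo `a m`. A prime factor of
  -- `n` divides `a m`, hence not `u`, so `u` can be cancelled.
  ∣-orbit-*⁻ : ∀ {n} k m → .{{NonZero n}} → .{{NonZero k}} →
    (∀ {q} → Prime q → q ∣ n → + q ℤ.∣ a m) → + n ℤ.∣ a (k * m) → + n ℤ.∣ a m
  ∣-orbit-*⁻ {n} (suc k) m primes∣aₘ n∣aₖₘ with orbit-rigid k m
  ... | ℤ.divides t aₖₘ-aₘ≡ =
    ∣ᵤ⇒∣ (ℤ.coprime-divisor (+ n) u (a m) n⊥u (∣⇒∣ᵤ (subst (+ n ℤ.∣_) aₖₘ≡ n∣aₖₘ)))
    where
    u = t ℤ.* a m ℤ.+ 1ℤ

    aₖₘ≡ : a (suc k * m) ≡ u ℤ.* a m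
    aₖₘ≡ = begin
      a (suc k * m)                         ≡⟨ split (a (suc k * m)) (a m) ⟩
      (a (suc k * m) ℤ.- a m) ℤ.+ a m       ≡⟨ cong (ℤ._+ a m) aₖₘ-aₘ≡ ⟩
      t ℤ.* (a m ℤ.* a m) ℤ.+ a m           ≡⟨ factor t (a m) ⟩
      u ℤ.* a m                             ∎
      where
      open ≡-Reasoning

      split : ∀ x y → x ≡ (x ℤ.- y) ℤ.+ y
      split = solve-∀

      factor : ∀ t x → t ℤ.* (x ℤ.* x) ℤ.+ x ≡ (t ℤ.* x ℤ.+ 1ℤ) ℤ.* x
      factor = solve-∀

    n⊥u : Coprime n ∣ u ∣
    n⊥u = noCommonPrime⇒coprime λ {q} q-prime q∣n q∣u → ¬prime[1] (subst Prime
      (∣1⇒≡1 (∣⇒∣ᵤ (ℤ.∣m+n∣m⇒∣n {+ q} {t ℤ.* a m} {1ℤ} (∣ᵤ⇒∣ q∣u)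
        (ℤ.∣n⇒∣m*n t (primes∣aₘ q-prime q∣n))))) q-prime)

  -- The vertex n is reached from m = n / p, where p is the greatest prime divisor of n.
  ∣-orbit⇒predecessor : ∀ n → .{{NonTrivial n}} → + n ℤ.∣ a n →
    ∃[ m ] ∃[ p ] n ≡ m * p × m < n × D d c m × Step d c m p
  ∣-orbit⇒predecessor n n∣aₙ with greatestPrimeDivisor n
  ... | p , p-prime , divides m n≡mp , p-greatest =
    m , p , n≡mp , quotient-< (divides m n≡mp) , (>-nonZero⁻¹ m , m∣aₘ) , step
    where
    instance
      _ = prime⇒nonZero p-prime
      _ = prime⇒nonTrivial p-prime
      _ = nonTrivial⇒nonZero n
      _ = quotient≢0 (divides m n≡mp)
      _ = m*n≢0 m p

    mp∣aₚₘ : + (m * p) ℤ.∣ a (p * m)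
    mp∣aₚₘ = subst₂ (λ k l → + k ℤ.∣ a l) n≡mp (trans n≡mp (*-comm m p)) n∣aₙ

    -- The small index satisfies `g ≤ q ≤ p`. If `p` does not divide `g`, then `g ∣ m * p` gives
    -- `g ∣ m`; otherwise `p ≤ g` and all three coincide.
    q∣n⇒ : ∀ {q} → Prime q → q ∣ n → + q ℤ.∣ a m ⊎ q ≡ p × + p ℤ.∣ a p
    q∣n⇒ {q} q-prime q∣n
      with g , g∣n , g≤q , q∣a_g ← ∣-orbit⇒∣-orbit-≤ d c q n {{prime⇒nonZero q-prime}}
             (ℤ.∣-trans (∣ᵤ⇒∣ q∣n) n∣aₙ)
      with p ∣? g
    ... | no p∤g = inj₁ (∣-orbit-∣ d c (coprime-divisor (Coprimality.sym (prime∤⇒coprime p-prime p∤g))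
            (subst (g ∣_) (trans n≡mp (*-comm m p)) g∣n)) q∣a_g)
    ... | yes p∣g = inj₂ (q≡p , subst₂ (λ k l → + k ℤ.∣ a l) q≡p g≡p q∣a_g)
      where
      q≤p = p-greatest q-prime q∣n
      p≤g : p ≤ g
      p≤g = ∣⇒≤ {{≢-nonZero λ { refl → ≢-nonZero⁻¹ n (0∣⇒≡0 g∣n) }}} p∣g
      q≡p = ≤-antisym q≤p (≤-trans p≤g g≤q)
      g≡p = ≤-antisym (≤-trans g≤q q≤p) p≤g

    primes∣aₘ : ∀ {q} → Prime q → q ∣ m → + q ℤ.∣ a m
    primes∣aₘ q-prime q∣m with q∣n⇒ q-prime (∣-trans q∣m (divides p (trans n≡mp (*-comm m p))))
    ... | inj₁ q∣aₘ          = q∣aₘ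
    -- Here `q` is `p`, and `p ∣ m` carries the divisibility from index `p` to index `m`.
    ... | inj₂ (refl , p∣aₚ) = ∣-orbit-∣ d c q∣m p∣aₚ

    m∣aₘ : + m ℤ.∣ a m
    m∣aₘ = ∣-orbit-*⁻ p m primes∣aₘ (ℤ.∣-trans (∣ᵤ⇒∣ (m∣m*n p)) mp∣aₚₘ)

    -- Now every prime factor of `m * p` divides `a m`, so the index `p * m` can be cut down to `m`
    -- for the whole of `m * p`.
    step₁ : + p ℤ.∣ a m → Step d c m p
    step₁ p∣aₘ = type₁ p-prime (*∣⇒v-< p-prime (∣-orbit-*⁻ p m primes∣aₘ′ mp∣aₚₘ))
      where
      primes∣aₘ′ : ∀ {q} → Prime q → q ∣ m * p → + q ℤ.∣ a m
      primes∣aₘ′ q-prime q∣mp with euclidsLemma m p q-prime q∣mp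
      ... | inj₁ q∣m = primes∣aₘ q-prime q∣m
      ... | inj₂ q∣p = ℤ.∣-trans (∣ᵤ⇒∣ q∣p) p∣aₘ

    step : Step d c m p
    step with + p ℤ.∣? a m
    ... | yes p∣aₘ = step₁ p∣aₘ
    ... | no  p∤aₘ with q∣n⇒ p-prime (divides m n≡mp)
    ...   | inj₁ p∣aₘ       = contradiction p∣aₘ p∤aₘ
    -- The valuation is 0 because `p ∣ m` would force `p ∣ a m` by `primes∣aₘ`.
    ...   | inj₂ (_ , p∣aₚ) = type₂ (p-prime , >-nonZero⁻¹ p , p∣aₚ) (∤⇒v≡0 (p∤aₘ ∘ primes∣aₘ p-prime))

  D⇒vertex : ∀ n → D d c n → Vertex d c n
  D⇒vertex = <-rec _ λ where
    zero       _   (() , _)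
    1          _   _          → one
    n@(2+ _) rec (_ , n∣aₙ) →
      let m , p , n≡mp , m<n , m∈D , step = ∣-orbit⇒predecessor n n∣aₙ
      in subst (Vertex d c) (sym n≡mp) (adjoin (rec m<n m∈D) step)

theorem1p4 : (d : ℕ) (c : ℤ) → 2 ≤ d → Digraph.vertices (G d c) ≐ D d c
theorem1p4 d c 2≤d =
  (λ {n} n∈G → >-nonZero⁻¹ n {{vertex⇒nonZero d c n∈G}} , vertex⇒∣-orbit d c n∈G) ,
  (λ {n} → D⇒vertex d c 2≤d n)
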